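{- For every positive integer $t$ there exists a constant $K_t$, depending only on $t$, such that for every positive integer $n$, every (not necessarily abelian) group $G$ of size $n$, and every subset $S\subseteq G\setminus\{0\}$ of size $k\ge K_t$, the set $S$ is $t$-weakly sequenceable.
   Context: Groups are written additively, even when non-abelian, with identity $0$. A subset $S$ of size $k$ of a group $G$ is $t$-weakly sequenceable if there is an ordering $(y_1,\ldots,y_k)$ of its elements such that the partial sums $s_0=0$ and $s_i=y_1+y_2+\cdots+y_i$ ($1\le i\le k$, sums taken in this order) satisfy $s_i\neq s_j$ for all $0\le i,j\le k$ with $1\le|i-j|\le t$. -}

module Defs where

open import Algebra.Bundles using (Group)
import Algebra.Definitions.RawMonoid as RawMonoidDefs
open import Data.Fin.Base using (Fin; toℕ; inject!)
open import Data.Nat.Base using (ℕ; suc; _≤_; ∣_-_∣)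
open import Data.Product.Base using (∃; proj₁)
open import Function.Base using (_∘_)
open import Function.Bundles using (Bijection)
open import Level using (Level; _⊔_)
open import Relation.Binary.Bundles using (Setoid)
import Relation.Binary.Construct.On as On
open import Relation.Binary.PropositionalEquality using (setoid)
open import Relation.Unary using (Pred)

private
  variable
    c ℓ p : Level

-- Cardinality is taken up to the setoid equality of A.
_HasSize_ : Setoid c ℓ → ℕ → Set (c ⊔ ℓ)
A HasSize k = Bijection (setoid (Fin k)) A

module _ (G : Group c ℓ) where

  -- sum iterates the group operation, which need not commute.
  open Group G using (Carrier; _≉_; rawMonoid) renaming (setoid to G-setoid)
  open RawMonoidDefs rawMonoid using (sum)

  -- The elements of S, compared by the equality of G alone: two proofs that
  -- the same element lies in S are not distinguished.
  subsetoid : Pred Carrier p → Setoid (c ⊔ p) ℓ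
  subsetoid S = On.setoid {B = ∃ S} G-setoid proj₁

  -- With y₁ , … , yₖ stored at the indices 0 , … , k-1, inject! embeds
  -- Fin (toℕ i) as the first i indices, so this is y₁ + (y₂ + (… + yᵢ)).
  partialSum : ∀ {k} → (Fin k → Carrier) → Fin (suc k) → Carrier
  partialSum y i = sum {n = toℕ i} (λ j → y (inject! {i = i} j))

  -- An ordering of the k-element set S is a bijection from Fin k onto S.
  WeaklySequenceable : ℕ → Pred Carrier p → ℕ → Set (c ⊔ ℓ ⊔ p)
  WeaklySequenceable t S k =
    ∃ λ (ordering : subsetoid S HasSize k) →
      let s = partialSum (proj₁ ∘ Bijection.to ordering) in
      ∀ (i j : Fin (suc k)) →
        1 ≤ ∣ toℕ i - toℕ j ∣ → ∣ toℕ i - toℕ j ∣ ≤ t → s i ≉ s j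

{-# OPTIONS --safe #-}
module Submission where

-- A window is a block of at most t consecutive entries, and an ordering works
-- iff no window sums to ε.  Inserting z between two lists creates a
-- zero-sum window for at most t² values of z, so a window-free list can be
-- extended greedily while more than t² elements are unused.  A leftover x may
-- fit nowhere, but it can be absorbed by a long window-free list: replace two
-- adjacent entries u v by q x r, and put u and v in the former places of q and
-- r.  Each place refuses at most t² elements, so with t² + 1 candidate places
-- for q and as many for r, a long range of adjacent pairs contains some u v
-- acceptable to all of them; q and then r are chosen afterwards, each
-- subject to at most t² exclusions.

open import Defs
open import Algebra.Bundles using (Group)
import Algebra.Definitions.RawMonoid as RawMonoidDefs
import Algebra.Properties.Group as GroupProperties
import Algebra.Solver.CommutativeMonoid as CommutativeMonoidSolver
open import Data.Fin.Base
  using (Fin; zero; suc; toℕ; fromℕ<; inject₁; _↑ˡ_; _↑ʳ_; splitAt; combine)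
open import Data.Fin.Properties as Fin
  using (any?; toℕ<n; toℕ-fromℕ<; inject₁-injective;
         ↑ˡ-injective; ↑ʳ-injective; splitAt-↑ˡ; splitAt-↑ʳ; combine-injective;
         injective⇒≤; ¬∀⟶∃¬)
open import Data.List.Base
  using (List; []; _∷_; [_]; _++_; length; take; drop; lookup; foldr; tabulate; allFin)
open import Data.List.Membership.Propositional.Properties using (∈-allFin; ∈-lookup; ∈-++⁺ˡ)
open import Data.List.Properties
  using (++-assoc; ++-identityʳ; length-++; length-tabulate; tabulate-lookup)
open import Data.List.Relation.Binary.Permutation.Propositional
  using (_↭_; ↭-refl; ↭-sym; ↭-trans; ↭-reflexive; ↭⇒↭ₛ)
open import Data.List.Relation.Binary.Permutation.Propositional.Properties
  using (↭-length; shift; ∈-resp-↭; ++⁺ˡ; ++⁺ʳ; ++-commutativeMonoid)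
import Data.List.Relation.Binary.Permutation.Setoid.Properties as PermutationSetoid
import Data.List.Relation.Unary.All as All
open import Data.List.Relation.Unary.Any.Properties using (tabulate⁻)
open import Data.List.Relation.Unary.Unique.Propositional using (Unique; []; _∷_)
open import Data.List.Relation.Unary.Unique.Propositional.Properties using (allFin⁺)
open import Data.Nat.Base
  using (ℕ; zero; suc; _+_; _*_; _∸_; _⊓_; _≤_; _≥_; _<_; z≤n; s≤s; s≤s⁻¹; ∣_-_∣)
open import Data.Nat.Properties
open import Data.Product.Base using (∃; ∃₂; _×_; _,_; proj₁; proj₂)
open import Data.Sum.Base using (_⊎_; inj₁; inj₂)
open import Function.Base using (_∘_; id)
open import Function.Bundles using (Bijection; mk⤖)
import Function.Construct.Composition as Composition
open import Level using (Level; _⊔_)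
open import Relation.Binary.Bundles using (Setoid)
open import Relation.Binary.Definitions using (_Respects_; tri<; tri≈; tri>)
open import Relation.Binary.PropositionalEquality
  using (_≡_; refl; sym; trans; cong; cong₂; subst; module ≡-Reasoning; setoid)
open import Relation.Nullary using (¬_; Dec; yes; no; contradiction)
open import Relation.Nullary.Decidable using (map′; _⊎-dec_)
open import Relation.Unary using (Pred; Decidable)

-- Predicates with boundedly many solutions.

private
  variable
    a b ℓ₁ ℓ₂ : Level
    A : Set a
    B : Set b

-- A code must determine its element but may depend on the proof of `P x`, so unions are counted by
-- tagging, without a canonical choice of disjunct or index.
AtMost : {A : Set a} → ℕ → Pred A ℓ₁ → Set (a ⊔ ℓ₁)
AtMost n P = ∃ λ (code : ∀ x → P x → Fin n) →
  ∀ {x y} (px : P x) (py : P y) → code x px ≡ code y py → x ≡ y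

module _ {A : Set a} where

  AtMost-⊎ : ∀ {m n} {P : Pred A ℓ₁} {Q : Pred A ℓ₂} →
             AtMost m P → AtMost n Q → AtMost (m + n) (λ x → P x ⊎ Q x)
  AtMost-⊎ {m = m} {n} {P} {Q} (f , f-inj) (g , g-inj) = code , code-inj
    where
    code : ∀ x → P x ⊎ Q x → Fin (m + n)
    code x (inj₁ px) = f x px ↑ˡ n
    code x (inj₂ qx) = m ↑ʳ g x qx
    ↑ˡ≢↑ʳ : ∀ i j → ¬ (i ↑ˡ n ≡ m ↑ʳ j)
    ↑ˡ≢↑ʳ i j eq
      with () ← trans (sym (splitAt-↑ˡ m i n)) (trans (cong (splitAt m) eq) (splitAt-↑ʳ m n j))
    code-inj : ∀ {x y} (u : P x ⊎ Q x) (v : P y ⊎ Q y) → code x u ≡ code y v → x ≡ y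
    code-inj (inj₁ u) (inj₁ v) eq = f-inj u v (↑ˡ-injective n _ _ eq)
    code-inj (inj₁ u) (inj₂ v) eq = contradiction eq (↑ˡ≢↑ʳ _ _)
    code-inj (inj₂ u) (inj₁ v) eq = contradiction (sym eq) (↑ˡ≢↑ʳ _ _)
    code-inj (inj₂ u) (inj₂ v) eq = g-inj u v (↑ʳ-injective m _ _ eq)

  AtMost-∃ : ∀ {m n} {P : Fin m → Pred A ℓ₁} →
             (∀ i → AtMost n (P i)) → AtMost (m * n) (λ x → ∃ λ i → P i x)
  AtMost-∃ {m = m} {n} {P} P-few = code , λ { (i , u) (j , v) → code-inj i u j v }
    where
    code : ∀ x → (∃ λ i → P i x) → Fin (m * n)
    code x (i , px) = combine i (proj₁ (P-few i) x px)
    code-inj : ∀ {x y} i (u : P i x) j (v : P j y) → code x (i , u) ≡ code y (j , v) → x ≡ y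
    code-inj i u j v eq with refl , eq′ ← combine-injective i _ j _ eq = proj₂ (P-few i) u v eq′

  AtMost-1 : ∀ {P : Pred A ℓ₁} → (∀ {x y} → P x → P y → x ≡ y) → AtMost 1 P
  AtMost-1 P-unique = (λ _ _ → zero) , λ px py _ → P-unique px py

AtMost-∘ : ∀ {n} {P : Pred B ℓ₁} (h : A → B) → (∀ {x y} → h x ≡ h y → x ≡ y) →
           AtMost n P → AtMost n (P ∘ h)
AtMost-∘ h h-inj (f , f-inj) = (λ x → f (h x)) , λ u v eq → h-inj (f-inj u v eq)

-- Pigeonhole: were `P` to hold throughout `Fin m`, the codes would inject `Fin m` into `Fin n`.
-- Decidability turns this refutation into a witness.
AtMost-escape : ∀ {m n} {P : Pred (Fin m) ℓ₁} → Decidable P → AtMost n P → n < m →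
                ∃ λ i → ¬ P i
AtMost-escape {m = m} {P = P} P? (f , f-inj) n<m = ¬∀⟶∃¬ m P P? λ all →
  <⇒≱ n<m (injective⇒≤ {f = λ i → f i (all i)} (f-inj _ _))

-- Lists: distinct entries, rearrangements and splittings.

module _ {A : Set a} where

  lookup-injective : ∀ {xs : List A} → Unique xs → ∀ {i j} → lookup xs i ≡ lookup xs j → i ≡ j
  lookup-injective (x∉ ∷ u) {zero}  {zero}  eq = refl
  lookup-injective (x∉ ∷ u) {zero}  {suc j} eq = contradiction eq (All.lookup x∉ (∈-lookup j))
  lookup-injective (x∉ ∷ u) {suc i} {zero}  eq = contradiction (sym eq) (All.lookup x∉ (∈-lookup i))
  lookup-injective (x∉ ∷ u) {suc i} {suc j} eq = cong suc (lookup-injective u eq)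

  Unique-++ˡ : ∀ (xs : List A) {ys} → Unique (xs ++ ys) → Unique xs
  Unique-++ˡ []       u        = []
  Unique-++ˡ (x ∷ xs) (x∉ ∷ u) =
    All.tabulate (λ z∈ → All.lookup x∉ (∈-++⁺ˡ z∈)) ∷ Unique-++ˡ xs u

  Unique-++ʳ : ∀ (xs : List A) {ys} → Unique (xs ++ ys) → Unique ys
  Unique-++ʳ []       u       = u
  Unique-++ʳ (x ∷ xs) (_ ∷ u) = Unique-++ʳ xs u

  Unique-resp-↭ : ∀ {xs ys : List A} → xs ↭ ys → Unique xs → Unique ys
  Unique-resp-↭ xs↭ys = PermutationSetoid.Unique-resp-↭ (setoid A) (↭⇒↭ₛ xs↭ys)

  -- Up to permutation `++` is commutative, so the commutative monoid solver applies, with single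
  -- entries as one-element lists. This is the exchange that absorbs `x`.
  rotate-↭ : ∀ (as bs gs qs₁ qs₂ hs rs₁ rs₂ ds : List A) {q r u v x} →
    (as ++ q ∷ x ∷ r ∷ bs) ++ (gs ++ ((qs₁ ++ u ∷ qs₂) ++ (hs ++ ((rs₁ ++ v ∷ rs₂) ++ ds)))) ↭
    x ∷ (as ++ u ∷ v ∷ bs) ++ (gs ++ ((qs₁ ++ q ∷ qs₂) ++ (hs ++ ((rs₁ ++ r ∷ rs₂) ++ ds))))
  rotate-↭ as bs gs qs₁ qs₂ hs rs₁ rs₂ ds {q} {r} {u} {v} {x} =
    solve 14 (λ as bs gs qs₁ qs₂ hs rs₁ rs₂ ds q r u v x →
      ((as ⊕ (q ⊕ (x ⊕ (r ⊕ bs)))) ⊕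
        (gs ⊕ ((qs₁ ⊕ (u ⊕ qs₂)) ⊕ (hs ⊕ ((rs₁ ⊕ (v ⊕ rs₂)) ⊕ ds))))) ⊜
      (x ⊕ ((as ⊕ (u ⊕ (v ⊕ bs))) ⊕
        (gs ⊕ ((qs₁ ⊕ (q ⊕ qs₂)) ⊕ (hs ⊕ ((rs₁ ⊕ (r ⊕ rs₂)) ⊕ ds)))))))
      ↭-refl as bs gs qs₁ qs₂ hs rs₁ rs₂ ds [ q ] [ r ] [ u ] [ v ] [ x ]
    where open CommutativeMonoidSolver (++-commutativeMonoid {A = A})

  before after : (xs : List A) → Fin (length xs) → List A
  before xs i = take (toℕ i) xs
  after  xs i = drop (suc (toℕ i)) xs

  before-lookup-after : ∀ xs i → xs ≡ before xs i ++ lookup xs i ∷ after xs i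
  before-lookup-after (x ∷ xs) zero    = refl
  before-lookup-after (x ∷ xs) (suc i) = cong (x ∷_) (before-lookup-after xs i)

  extract-↭ : ∀ xs i {ys} → (before xs i ++ after xs i) ++ lookup xs i ∷ ys ↭ xs ++ ys
  extract-↭ xs i {ys} = ↭-trans (shift _ (before xs i ++ after xs i) ys)
    (↭-trans (++⁺ʳ ys (↭-sym (shift (lookup xs i) (before xs i) (after xs i))))
      (↭-reflexive (cong (_++ ys) (sym (before-lookup-after xs i)))))

  absorb-↭ : ∀ {x ys zs} (xs : List A) → ys ↭ x ∷ zs → xs ++ ys ↭ x ∷ xs ++ zs
  absorb-↭ xs ys↭ = ↭-trans (++⁺ˡ xs ys↭) (shift _ xs _)

  split-adjacent : ∀ (x : A) xs (i : Fin (length xs)) →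
                   ∃₂ λ ys zs → x ∷ xs ≡ ys ++ lookup (x ∷ xs) (inject₁ i) ∷ lookup xs i ∷ zs
  split-adjacent x (y ∷ xs) zero    = [] , xs , refl
  split-adjacent x (y ∷ xs) (suc i) with ys , zs , eq ← split-adjacent y xs i =
    x ∷ ys , zs , cong (x ∷_) eq

  split-length : ∀ m {n} (xs : List A) → m + n ≤ length xs →
                 ∃₂ λ ys zs → xs ≡ ys ++ zs × length ys ≡ m × n ≤ length zs
  split-length zero    xs       h       = [] , xs , refl , refl , h
  split-length (suc m) (x ∷ xs) (s≤s h) with ys , zs , eq , l , h′ ← split-length m xs h =
    x ∷ ys , zs , cong (x ∷_) eq , cong suc l , h′

  take-++-≤ : ∀ n (xs : List A) {ys} → n ≤ length xs → take n (xs ++ ys) ≡ take n xs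
  take-++-≤ zero    xs       h       = refl
  take-++-≤ (suc n) (x ∷ xs) (s≤s h) = cong (x ∷_) (take-++-≤ n xs h)

  take-++-+ : ∀ (xs : List A) {ys} n → take (length xs + n) (xs ++ ys) ≡ xs ++ take n ys
  take-++-+ []       n = refl
  take-++-+ (x ∷ xs) n = cong (x ∷_) (take-++-+ xs n)

  take-⊓-++ : ∀ n (xs : List A) {ys} → take (n ⊓ length xs) (xs ++ ys) ≡ take n xs
  take-⊓-++ zero    xs       = refl
  take-⊓-++ (suc n) []       = refl
  take-⊓-++ (suc n) (x ∷ xs) = cong (x ∷_) (take-⊓-++ n xs)

  drop-++-∸ : ∀ (xs ys : List A) → drop (length (xs ++ ys) ∸ length ys) (xs ++ ys) ≡ ys
  drop-++-∸ xs ys rewrite length-++ xs {ys} | m+n∸n≡m (length xs) (length ys) = go xs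
    where
    go : ∀ xs → drop (length xs) (xs ++ ys) ≡ ys
    go []       = refl
    go (x ∷ xs) = go xs

-- Numerical constants.

module _ (t : ℕ) where

  -- AtMost-∃ over two indices in Fin t, applied to AtMost 1, gives t² in this form.
  bound : ℕ
  bound = t * (t * 1)

  -- Each of the suc bound places for q, and for r, excludes at most bound adjacent pairs.
  width : ℕ
  width = suc bound * bound + suc bound * bound

  -- The pairs, a gap, the places for q, a gap, the places for r; the gaps of length t keep
  -- the three modifications out of each other's windows.
  enough : ℕ
  enough = suc (suc width) + (t + (suc bound + (t + (suc bound + 0))))

-- Window-free lists.

module _ {c ℓ i} (G : Group c ℓ) {I : Set i} (f : I → Group.Carrier G) (t : ℕ) where

  private
    open module G = Group G using (Carrier; _≈_; _≉_; _∙_; ε)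

  -- Entries are labels in `I` rather than group elements, so that uniqueness and permutation of
  -- lists concern propositional equality only.
  total : List I → Carrier
  total = foldr (λ u s → f u ∙ s) ε

  total-++ : ∀ xs ys → total (xs ++ ys) ≈ total xs ∙ total ys
  total-++ []       ys = G.sym (G.identityˡ _)
  total-++ (x ∷ xs) ys = G.trans (G.∙-congˡ (total-++ xs ys)) (G.sym (G.assoc _ _ _))

  -- Near the end of the list take truncates, which only repeats shorter windows.
  data WindowFree : List I → Set (i ⊔ ℓ) where
    []  : WindowFree []
    _∷_ : ∀ {x xs} → (∀ d → d < t → total (x ∷ take d xs) ≉ ε) → WindowFree xs → WindowFree (x ∷ xs)

  WindowFree-++ʳ : ∀ xs {ys} → WindowFree (xs ++ ys) → WindowFree ys
  WindowFree-++ʳ []       w       = w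
  WindowFree-++ʳ (x ∷ xs) (_ ∷ w) = WindowFree-++ʳ xs w

  WindowFree-++ˡ : ∀ xs {ys} → WindowFree (xs ++ ys) → WindowFree xs
  WindowFree-++ˡ []       w            = []
  WindowFree-++ˡ (x ∷ xs) {ys} (h ∷ w) =
    -- A window cut off by the end of `xs` is a shorter window of the longer list.
    (λ d d<t → subst (λ zs → total (x ∷ zs) ≉ ε) (take-⊓-++ d xs)
                 (h (d ⊓ length xs) (≤-<-trans (m⊓n≤m d _) d<t)))
    ∷ WindowFree-++ˡ xs w

  -- A window of length at most t cannot reach across an overlap of length t.
  WindowFree-glue : ∀ xs {ys zs} → t ≤ length ys →
                    WindowFree (xs ++ ys) → WindowFree (ys ++ zs) → WindowFree (xs ++ (ys ++ zs))
  WindowFree-glue []       t≤ w       v = v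
  WindowFree-glue (x ∷ xs) {ys} {zs} t≤ (h ∷ w) v =
    (λ d d<t → subst (λ us → total (x ∷ us) ≉ ε) (sym (begin
      take d (xs ++ (ys ++ zs)) ≡⟨ cong (take d) (++-assoc xs ys zs) ⟨
      take d ((xs ++ ys) ++ zs) ≡⟨ take-++-≤ d (xs ++ ys) (d≤ d<t) ⟩
      take d (xs ++ ys)         ∎)) (h d d<t))
    ∷ WindowFree-glue xs t≤ w v
    where
    open ≡-Reasoning
    d≤ : ∀ {d} → d < t → d ≤ length (xs ++ ys)
    d≤ d<t = ≤-trans (<⇒≤ d<t) (≤-trans t≤
      (subst (length ys ≤_) (sym (length-++ xs)) (m≤n+m (length ys) (length xs))))

  -- A window that avoids `z` lies in `xs` or in `ys`; any other consists of a suffix `vs` of `xs`,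
  -- then `z`, then a prefix of `ys`.
  WindowFree-insert : ∀ xs z ys → WindowFree xs → WindowFree ys →
    (∀ us vs d → xs ≡ us ++ vs → length vs < t → d < t → total (vs ++ z ∷ take d ys) ≉ ε) →
    WindowFree (xs ++ z ∷ ys)
  WindowFree-insert []       z ys _ v ok =
    (λ d d<t → ok [] [] d refl (≤-<-trans z≤n d<t) d<t) ∷ v
  WindowFree-insert (x ∷ xs) z ys (h ∷ w) v ok =
    head ∷ WindowFree-insert xs z ys w v (λ us vs d eq → ok (x ∷ us) vs d (cong (x ∷_) eq))
    where
    head : ∀ d → d < t → total (x ∷ take d (xs ++ z ∷ ys)) ≉ ε
    head d d<t with d ≤? length xs
    ... | yes d≤ = subst (λ zs → total (x ∷ zs) ≉ ε) (sym (take-++-≤ d xs d≤)) (h d d<t)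
    -- The window passes `z`: `d` counts the rest of `xs`, `z` itself and `e` places after it, so
    -- `vs` is all of `x ∷ xs`.
    ... | no d≰ with e , refl ← m≤n⇒∃[o]m+o≡n (≰⇒> d≰) =
      subst (λ zs → total (x ∷ zs) ≉ ε)
        (sym (trans (cong (λ n → take n (xs ++ z ∷ ys)) (sym (+-suc (length xs) e)))
                    (take-++-+ xs (suc e))))
        (ok [] (x ∷ xs) e refl (≤-<-trans (m≤m+n _ e) d<t) (≤-<-trans (m≤n+m e _) d<t))

  -- From windows to partial sums.

  total-take-≉ : ∀ m d xs → WindowFree xs → d < t → m + suc d ≤ length xs →
                 total (take m xs) ≉ total (take (m + suc d) xs)
  -- With the common prefix cancelled, the equation says that a window of `suc d` entries sums to
  -- `ε`.
  total-take-≉ zero    d (x ∷ xs) (h ∷ _) d<t _        eq = h d d<t (G.sym eq)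
  total-take-≉ (suc m) d (x ∷ xs) (_ ∷ w) d<t (s≤s le) eq =
    total-take-≉ m d xs w d<t le (GroupProperties.∙-cancelˡ G _ _ _ eq)

  -- Both sides are nested to the right and end in `ε`, so the equality is propositional.
  partialSum≡total : ∀ {k} (σ : Fin k → I) (m : Fin (suc k)) →
                     partialSum G (f ∘ σ) m ≡ total (take (toℕ m) (tabulate σ))
  partialSum≡total {zero}  σ zero    = refl
  partialSum≡total {suc k} σ zero    = refl
  partialSum≡total {suc k} σ (suc m) = cong (f (σ zero) ∙_) (partialSum≡total (σ ∘ suc) m)

  partialSum-< : ∀ {k} (σ : Fin k → I) → WindowFree (tabulate σ) → ∀ (m n : Fin (suc k)) →
                 toℕ m < toℕ n → toℕ n ∸ toℕ m ≤ t →
                 partialSum G (f ∘ σ) m ≉ partialSum G (f ∘ σ) n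
  partialSum-< σ w m n m<n n∸m≤t eq with d , m+d≡n ← m≤n⇒∃[o]m+o≡n m<n =
    total-take-≉ (toℕ m) d (tabulate σ) w
      (subst (_≤ t) (trans (cong (_∸ toℕ m) (sym m+1+d≡n)) (m+n∸m≡n (toℕ m) (suc d))) n∸m≤t)
      (≤-trans (≤-reflexive m+1+d≡n)
        (≤-trans (s≤s⁻¹ (toℕ<n n)) (≤-reflexive (sym (length-tabulate σ)))))
      (G.trans (G.reflexive (sym (partialSum≡total σ m))) (G.trans eq (G.reflexive
        (trans (partialSum≡total σ n) (cong (λ z → total (take z (tabulate σ))) (sym m+1+d≡n))))))
    where
    m+1+d≡n : toℕ m + suc d ≡ toℕ n
    m+1+d≡n = trans (+-suc (toℕ m) d) m+d≡n

  partialSum-≉ : ∀ {k} (σ : Fin k → I) → WindowFree (tabulate σ) → ∀ (m n : Fin (suc k)) →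
                 1 ≤ ∣ toℕ m - toℕ n ∣ → ∣ toℕ m - toℕ n ∣ ≤ t →
                 partialSum G (f ∘ σ) m ≉ partialSum G (f ∘ σ) n
  partialSum-≉ σ w m n 1≤ ≤t eq with <-cmp (toℕ m) (toℕ n)
  ... | tri< m<n _ _ = partialSum-< σ w m n m<n (subst (_≤ t) (m≤n⇒∣m-n∣≡n∸m (<⇒≤ m<n)) ≤t) eq
  ... | tri≈ _ m≡n _ = <⇒≢ 1≤ (sym (m≡n⇒∣m-n∣≡0 m≡n))
  ... | tri> _ _ n<m = partialSum-< σ w n m n<m (subst (_≤ t) (m≤n⇒∣n-m∣≡n∸m (<⇒≤ n<m)) ≤t) (G.sym eq)

  -- `drop` keeps the last `m` entries of `xs`. As `m` and `n` range independently over `Fin t`, the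
  -- t² choices include every window of length at most `t` through `z`.
  Blocked : List I → List I → Pred I ℓ
  Blocked xs ys z = ∃ λ (m : Fin t) → ∃ λ (n : Fin t) →
    total (drop (length xs ∸ toℕ m) xs ++ z ∷ take (toℕ n) ys) ≈ ε

  WindowFree-insert-unblocked : ∀ xs {z} ys → WindowFree xs → WindowFree ys → ¬ Blocked xs ys z →
                                WindowFree (xs ++ z ∷ ys)
  WindowFree-insert-unblocked xs {z} ys w v free = WindowFree-insert xs z ys w v ok
    where
    ok : ∀ us vs d → xs ≡ us ++ vs → length vs < t → d < t → total (vs ++ z ∷ take d ys) ≉ ε
    ok us vs d refl l<t d<t eq = free (fromℕ< l<t , fromℕ< d<t , subst (_≈ ε) (sym (cong₂
      (λ as bs → total (as ++ z ∷ bs))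
      (trans (cong (λ n → drop (length (us ++ vs) ∸ n) (us ++ vs)) (toℕ-fromℕ< l<t))
             (drop-++-∸ us vs))
      (cong (λ n → take n ys) (toℕ-fromℕ< d<t)))) eq)

  -- Choosing and exchanging unblocked entries.

  module _ (f-inj : ∀ {u v} → f u ≈ f v → u ≡ v) (_≈?_ : ∀ x y → Dec (x ≈ y)) where

    Blocked? : ∀ xs ys → Decidable (Blocked xs ys)
    Blocked? xs ys z = any? λ m → any? λ n → _ ≈? ε

    -- For fixed `m` and `n` the neighbours of `z` are fixed; cancelling them on both sides
    -- determines `f z`, hence `z`.
    Blocked-AtMost : ∀ xs ys → AtMost (bound t) (Blocked xs ys)
    Blocked-AtMost xs ys = AtMost-∃ λ m → AtMost-∃ λ n → AtMost-1
      (same (drop (length xs ∸ toℕ m) xs) (take (toℕ n) ys))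
      where
      open GroupProperties G using (∙-cancelˡ; ∙-cancelʳ)
      same : ∀ as bs {u v} → total (as ++ u ∷ bs) ≈ ε → total (as ++ v ∷ bs) ≈ ε → u ≡ v
      same as bs {u} {v} eq eq′ = f-inj (∙-cancelʳ _ _ _ (∙-cancelˡ (total as) _ _
        (G.trans (G.sym (total-++ as (u ∷ bs)))
          (G.trans (G.trans eq (G.sym eq′)) (total-++ as (v ∷ bs))))))

    find-unblocked : ∀ xs ys zs → Unique zs → bound t < length zs →
                     ∃ λ n → ¬ Blocked xs ys (lookup zs n)
    find-unblocked xs ys zs u lt = AtMost-escape (λ n → Blocked? xs ys (lookup zs n))
      (AtMost-∘ (lookup zs) (lookup-injective u) (Blocked-AtMost xs ys)) lt

    -- An element outside this predicate may replace any entry of `qs`, so a pair `u v` can be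
    -- chosen before the places it moves to.
    BlockedIn : List I → List I → List I → Pred I ℓ
    BlockedIn gs qs hs z = ∃ λ n → Blocked (gs ++ before qs n) (after qs n ++ hs) z

    BlockedIn? : ∀ gs qs hs → Decidable (BlockedIn gs qs hs)
    BlockedIn? gs qs hs z = any? λ n → Blocked? _ _ z

    BlockedIn-AtMost : ∀ gs qs hs → AtMost (length qs * bound t) (BlockedIn gs qs hs)
    BlockedIn-AtMost gs qs hs = AtMost-∃ λ n → Blocked-AtMost _ _

    -- Removing the old entry leaves a prefix and a suffix that are still window-free, so
    -- replacement is insertion between them.
    WindowFree-replace : ∀ xs ys n {z zs} → WindowFree (xs ++ (ys ++ zs)) →
      ¬ Blocked (xs ++ before ys n) (after ys n ++ zs) z →
      WindowFree (xs ++ ((before ys n ++ z ∷ after ys n) ++ zs))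
    WindowFree-replace xs ys n {z} {zs} w free = subst WindowFree
      (trans (++-assoc xs (before ys n) _) (cong (xs ++_) (sym (++-assoc (before ys n) _ zs))))
      (WindowFree-insert-unblocked _ _ (WindowFree-++ˡ (xs ++ before ys n) w′)
        (tail (WindowFree-++ʳ (xs ++ before ys n) w′)) free)
      where
      tail : ∀ {u us} → WindowFree (u ∷ us) → WindowFree us
      tail (_ ∷ v) = v
      w′ : WindowFree ((xs ++ before ys n) ++ lookup ys n ∷ (after ys n ++ zs))
      w′ = subst WindowFree (begin
        xs ++ (ys ++ zs)
          ≡⟨ cong (λ us → xs ++ (us ++ zs)) (before-lookup-after ys n) ⟩
        xs ++ ((before ys n ++ lookup ys n ∷ after ys n) ++ zs)
          ≡⟨ cong (xs ++_) (++-assoc (before ys n) _ zs) ⟩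
        xs ++ (before ys n ++ lookup ys n ∷ (after ys n ++ zs))
          ≡⟨ ++-assoc xs _ _ ⟨
        (xs ++ before ys n) ++ lookup ys n ∷ (after ys n ++ zs)
          ∎) w
        where open ≡-Reasoning

    WindowFree-[] : ∀ {x} → f x ≉ ε → WindowFree [ x ]
    WindowFree-[] fx≉ε = (λ { zero    _ eq → fx≉ε (G.trans (G.sym (G.identityʳ _)) eq)
                           ; (suc d) _ eq → fx≉ε (G.trans (G.sym (G.identityʳ _)) eq) }) ∷ []

    -- Absorbing one more element.

    module _ (p : I) (ps gs qs hs rs ds : List I)
             (t≤gs : t ≤ length gs) (t≤hs : t ≤ length hs)
             (qs-many : bound t < length qs) (rs-many : bound t < length rs)
             (ps-many : length qs * bound t + length rs * bound t < length ps)
             (ps-unique : Unique (p ∷ ps)) (qs-unique : Unique qs) (rs-unique : Unique rs)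
             (free : WindowFree ((p ∷ ps) ++ (gs ++ (qs ++ (hs ++ (rs ++ ds))))))
             (x : I) (fx≉ε : f x ≉ ε) where

      -- No test is made of `x` beyond `fx≉ε`: a longer window through `x` contains `q` or `r` and
      -- is covered by their tests. The pair `u v` comes first because it fixes `as` and `bs`,
      -- against which `q` and `r` are tested.
      insert-into-blocks : ∃ λ zs →
        zs ↭ x ∷ (p ∷ ps) ++ (gs ++ (qs ++ (hs ++ (rs ++ ds)))) × WindowFree zs
      insert-into-blocks
        -- Here `n` indexes adjacent pairs; a pair is refused if its first entry is blocked
        -- somewhere in `qs` or its second somewhere in `rs`.
        with m , m-free ← AtMost-escape
               (λ n → BlockedIn? gs qs hs (lookup (p ∷ ps) (inject₁ n))
                      ⊎-dec BlockedIn? hs rs ds (lookup ps n))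
               (AtMost-⊎ (AtMost-∘ (λ n → lookup (p ∷ ps) (inject₁ n))
                            (inject₁-injective ∘ lookup-injective ps-unique)
                            (BlockedIn-AtMost gs qs hs))
                         (AtMost-∘ (lookup ps)
                            (lookup-injective (Unique-++ʳ [ p ] ps-unique))
                            (BlockedIn-AtMost hs rs ds)))
               ps-many
        with as , bs , eq ← split-adjacent p ps m
        -- `q` is tested against `as` and `x` only; windows that also contain `r` are left to the
        -- test of `r`.
        with j , j-free ← find-unblocked as [ x ] qs qs-unique qs-many
        with k , k-free ← find-unblocked (as ++ lookup qs j ∷ [ x ]) (bs ++ gs) rs rs-unique rs-many
        = new , permuted
        -- The gaps `gs` and `hs` are unchanged and at least `t` long, so the three modified
        -- stretches are checked separately.
        , WindowFree-glue (as ++ q ∷ x ∷ r ∷ bs) t≤gs left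
            (subst WindowFree (++-assoc gs qs′ _)
              (WindowFree-glue (gs ++ qs′) t≤hs
                (subst WindowFree (sym (++-assoc gs qs′ hs))
                  (WindowFree-replace gs qs j free-q (λ b → m-free (inj₁ (j , b)))))
                (WindowFree-replace hs rs k free-r (λ b → m-free (inj₂ (k , b))))))
        where
        u v q r : I
        u = lookup (p ∷ ps) (inject₁ m)
        v = lookup ps m
        q = lookup qs j
        r = lookup rs k

        qs′ rs′ new : List I
        qs′ = before qs j ++ u ∷ after qs j
        rs′ = before rs k ++ v ∷ after rs k
        new = (as ++ q ∷ x ∷ r ∷ bs) ++ (gs ++ (qs′ ++ (hs ++ (rs′ ++ ds))))

        permuted : new ↭ x ∷ (p ∷ ps) ++ (gs ++ (qs ++ (hs ++ (rs ++ ds))))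
        permuted = subst (new ↭_)
          (sym (trans (cong (λ zs → x ∷ zs ++ (gs ++ (qs ++ (hs ++ (rs ++ ds))))) eq)
            (cong₂ (λ ys zs → x ∷ (as ++ u ∷ v ∷ bs) ++ (gs ++ (ys ++ (hs ++ (zs ++ ds)))))
              (before-lookup-after qs j) (before-lookup-after rs k))))
          (rotate-↭ as bs gs (before qs j) (after qs j) hs (before rs k) (after rs k) ds)

        free-gs : WindowFree (gs ++ (qs ++ (hs ++ (rs ++ ds))))
        free-gs = WindowFree-++ʳ (p ∷ ps) free

        free-r : WindowFree (hs ++ (rs ++ ds))
        free-r = WindowFree-++ʳ qs (WindowFree-++ʳ gs free-gs)

        free-q : WindowFree (gs ++ (qs ++ hs))
        free-q = WindowFree-++ˡ (gs ++ (qs ++ hs)) (subst WindowFree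
          (trans (cong (gs ++_) (sym (++-assoc qs hs _))) (sym (++-assoc gs (qs ++ hs) _))) free-gs)

        free-as : WindowFree (as ++ u ∷ v ∷ (bs ++ gs))
        free-as = subst WindowFree (trans (cong (_++ gs) eq) (++-assoc as _ gs))
          (WindowFree-++ˡ ((p ∷ ps) ++ gs) (subst WindowFree (sym (++-assoc (p ∷ ps) gs _)) free))

        free-bs : WindowFree (bs ++ gs)
        free-bs = WindowFree-++ʳ (u ∷ v ∷ []) (WindowFree-++ʳ as free-as)

        left : WindowFree ((as ++ q ∷ x ∷ r ∷ bs) ++ gs)
        left = subst WindowFree
          (trans (++-assoc as (q ∷ [ x ]) _) (sym (++-assoc as (q ∷ x ∷ r ∷ bs) gs)))
          (WindowFree-insert-unblocked (as ++ q ∷ [ x ]) (bs ++ gs)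
            (WindowFree-insert-unblocked as [ x ] (WindowFree-++ˡ as free-as) (WindowFree-[] fx≉ε) j-free)
            free-bs k-free)

    insert-element : ∀ {x xs} → f x ≉ ε → Unique xs → enough t ≤ length xs → WindowFree xs →
                     ∃ λ zs → zs ↭ x ∷ xs × WindowFree zs
    insert-element {x} {xs} fx≉ε uniq long free
      -- The `width t + 2` entries of `p ∷ ps` form `width t + 1` adjacent pairs, one more than can
      -- be refused.
      with p ∷ ps , xs₁ , refl , |ps| , long₁ ← split-length (suc (suc (width t))) xs long
      with gs , xs₂ , refl , |gs| , long₂ ← split-length t xs₁ long₁
      with qs , xs₃ , refl , |qs| , long₃ ← split-length (suc (bound t)) xs₂ long₂
      with hs , xs₄ , refl , |hs| , long₄ ← split-length t xs₃ long₃
      with rs , ds , refl , |rs| , _ ← split-length (suc (bound t)) xs₄ long₄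
      = insert-into-blocks p ps gs qs hs rs ds
          (≤-reflexive (sym |gs|)) (≤-reflexive (sym |hs|))
          (≤-reflexive (sym |qs|)) (≤-reflexive (sym |rs|))
          (≤-reflexive (trans
            (cong suc (cong₂ (λ m n → m * bound t + n * bound t) |qs| |rs|)) (sym (suc-injective |ps|))))
          (Unique-++ˡ (p ∷ ps) uniq) (Unique-++ˡ qs uniq₁)
          (Unique-++ˡ rs (Unique-++ʳ hs (Unique-++ʳ qs uniq₁)))
          free x fx≉ε
      where
      uniq₁ : Unique (qs ++ (hs ++ (rs ++ ds)))
      uniq₁ = Unique-++ʳ gs (Unique-++ʳ (p ∷ ps) uniq)

    -- Greedy extension, then absorption of the leftovers.

    module _ (f≉ε : ∀ u → f u ≉ ε) where

      -- Each step moves one element from `pool` to the list, so `n + length xs` is invariant: once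
      -- `pool` is too small for a greedy choice, the list is long enough to absorb. Recursion is on
      -- `n`, since a pool with an inner entry removed is not a subterm.
      complete : ∀ n pool xs → length pool ≡ n → enough t + bound t ≤ n + length xs →
                 Unique (pool ++ xs) → WindowFree xs → ∃ λ zs → zs ↭ pool ++ xs × WindowFree zs
      complete zero    []           xs _   _    _    free = xs , ↭-refl , free
      complete (suc n) (x ∷ pool) xs |p| long uniq free with suc (bound t) ≤? suc n
      ... | yes bound<1+n
        -- The new element goes to the front of the list.
        with k , k-free ← find-unblocked [] xs (x ∷ pool) (Unique-++ˡ (x ∷ pool) uniq)
               (≤-trans bound<1+n (≤-reflexive (sym |p|)))
        with zs , zs↭ , free′ ← complete n (before (x ∷ pool) k ++ after (x ∷ pool) k)
               (lookup (x ∷ pool) k ∷ xs)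
               (suc-injective (trans (sym (↭-length (shift _ (before (x ∷ pool) k) _)))
                 (trans (cong length (sym (before-lookup-after (x ∷ pool) k))) |p|)))
               (≤-trans long (≤-reflexive (sym (+-suc n (length xs)))))
               (Unique-resp-↭ (↭-sym (extract-↭ (x ∷ pool) k)) uniq)
               (WindowFree-insert-unblocked [] xs [] free k-free)
        = zs , ↭-trans zs↭ (extract-↭ (x ∷ pool) k) , free′
      -- Now `suc n ≤ bound t`, so `long` yields `enough t ≤ length xs`.
      ... | no bound≮1+n
        with ys , ys↭ , free₁ ← insert-element (f≉ε x) (Unique-++ʳ (x ∷ pool) uniq)
               (+-cancelʳ-≤ (bound t) (enough t) (length xs) (≤-trans long
                 (subst (suc n + length xs ≤_) (+-comm (bound t) (length xs))
                   (+-monoˡ-≤ (length xs) (≮⇒≥ bound≮1+n))))) free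
        with zs , zs↭ , free₂ ← complete n pool ys (suc-injective |p|)
               (≤-trans long (≤-reflexive (trans (sym (+-suc n (length xs)))
                 (cong (n +_) (sym (↭-length ys↭))))))
               (Unique-resp-↭ (↭-sym (absorb-↭ pool ys↭)) uniq) free₁
        = zs , ↭-trans zs↭ (absorb-↭ pool ys↭) , free₂

-- From lists back to orderings.

module _ {A : Set a} where

  -- With `A` independent of `k` the length equation can be matched; for `xs : List (Fin k)` that
  -- would make `k` depend on itself.
  toFunction : ∀ k (xs : List A) → length xs ≡ k →
               ∃ λ (σ : Fin k → A) → tabulate σ ≡ xs × (Unique xs → ∀ {i j} → σ i ≡ σ j → i ≡ j)
  toFunction k xs refl = lookup xs , tabulate-lookup xs , lookup-injective

toPermutation : ∀ {k} (xs : List (Fin k)) → xs ↭ allFin k →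
                ∃ λ (π : setoid (Fin k) HasSize k) → tabulate (Bijection.to π) ≡ xs
toPermutation {k} xs xs↭
  with σ , refl , σ-inj ← toFunction k xs (trans (↭-length xs↭) (length-tabulate id))
  = mk⤖ (σ-inj (Unique-resp-↭ (↭-sym xs↭) (allFin⁺ k)) , surj) , refl
  where
  surj : ∀ y → ∃ λ i → ∀ {z} → z ≡ i → σ z ≡ y
  surj y with i , y≡σi ← tabulate⁻ (∈-resp-↭ (↭-sym xs↭) (∈-allFin y)) =
    i , λ { refl → sym y≡σi }

-- Elements are compared through their preimages in `Fin n`. Finiteness of the group thus makes the
-- searches for unblocked elements effective.
HasSize⇒≈-decidable : ∀ {c ℓ n} {X : Setoid c ℓ} → X HasSize n → ∀ x y → Dec (Setoid._≈_ X x y)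
HasSize⇒≈-decidable {X = X} size x y = map′
  (λ eq → X.trans (X.sym (to-index x)) (X.trans (to-cong eq) (to-index y)))
  (λ x≈y → injective (X.trans (to-index x) (X.trans x≈y (X.sym (to-index y)))))
  (index x Fin.≟ index y)
  where
  module X = Setoid X
  open Bijection size using (to; injective; strictlySurjective) renaming (cong to to-cong)
  index = proj₁ ∘ strictlySurjective
  to-index : ∀ z → to (index z) X.≈ z
  to-index = proj₂ ∘ strictlySurjective

theorem1p4 : ∀ {c ℓ p : Level} (t : ℕ) → 1 ≤ t →
    ∃ λ (K : ℕ) →
    ∀ (n : ℕ) → 1 ≤ n →
    (G : Group c ℓ) → Group.setoid G HasSize n →
    (S : Pred (Group.Carrier G) p) → S Respects (Group._≈_ G) →
    (∀ x → S x → Group._≉_ G x (Group.ε G)) →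
    (k : ℕ) → subsetoid G S HasSize k → k ≥ K →
    WeaklySequenceable G t S k
theorem1p4 t _ = enough t + bound t , λ n _ G G-size S _ S≉ε k S-size k≥K →
  -- The labels are the indices in `Fin k` of the given enumeration of `S`. All of them start in the
  -- pool, with the list empty.
  let f = proj₁ ∘ Bijection.to S-size
      xs , xs↭ , free = complete G f t (Bijection.injective S-size) (HasSize⇒≈-decidable G-size)
        (λ u → S≉ε (f u) (proj₂ (Bijection.to S-size u))) k (allFin k) [] (length-tabulate id)
        (≤-trans k≥K (≤-reflexive (sym (+-identityʳ k))))
        (subst Unique (sym (++-identityʳ (allFin k))) (allFin⁺ k)) []
      π , π≡xs = toPermutation xs (subst (xs ↭_) (++-identityʳ (allFin k)) xs↭)
  in Composition.bijection π S-size
   , partialSum-≉ G f t (Bijection.to π) (subst (WindowFree G f t) (sym π≡xs) free)
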